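{- Let $m$ be a positive integer. The $l$-operator has the following properties: (i) if $B$ is $m$-restricted then $l(B)$ is $m$-increasing; (ii) if $B$ is $m$-increasing then $l(B)$ is $m$-restricted; (iii) if $B$ is a singleton board then $l(l(B))=B$, so $l$ is an involution on singleton boards.
   Context: A Ferrers board given by column heights $0\le b_1\le\dots\le b_n$ is the set of the $b_j$ lowest cells of column $j$ in the first-quadrant grid; boards are sets of cells, so left columns of height $0$ may be added or removed. Let $\mathcal{Q}_i$ be the cells in level $i$, i.e. rows $(i-1)m+1,\dots,im$. With $l_i=|B\cap\mathcal{Q}_i|$ and $t$ the largest index with $l_t\ne0$, $l(B)$ is the Ferrers board $(l_t,l_{t-1},\dots,l_1)$. $\lfloor n\rfloor_m$ is the largest multiple of $m$ that is $\le n$. $B=(b_1,\dots,b_n)$ is a singleton board if for all $i<n$, $\lfloor b_i\rfloor_m\ne b_i$ implies $\lfloor b_{i+1}\rfloor_m>\lfloor b_i\rfloor_m$. $B$ is $m$-increasing if, written without zero columns, $b_1>0$ and $b_{j+1}\ge b_j+m$ for all $j$. $B$ is $m$-restricted if, written as $(b_0,b_1,\dots,b_n)$ with $b_0=0$, $b_{j+1}\le b_j+m$ for all $j\ge0$. -}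

module Defs where

open import Data.Nat using (ℕ; zero; suc; _+_; _*_; _∸_; _≤_; _<_; _⊓_; _⊔_; NonZero)
open import Data.Nat.DivMod using (_/_)
open import Data.List using (List; []; _∷_; map; reverse; upTo; foldr)
open import Data.Nat.ListAction using (sum)
open import Data.List.Relation.Unary.Linked using (Linked)
open import Data.List.Relation.Unary.All using (All)
open import Relation.Binary.PropositionalEquality using (_≡_; _≢_)

-- A board is given by its list of column heights (b₁, …, bₙ), left to right.
Board : Set
Board = List ℕ

IsFerrers : Board → Set
IsFerrers B = Linked _≤_ B

-- Remove left columns of height 0 (boards are sets of cells).
stripZeros : Board → Board
stripZeros []           = []
stripZeros (zero ∷ bs)  = stripZeros bs
stripZeros (suc b ∷ bs) = suc b ∷ bs

_≈B_ : Board → Board → Set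
B ≈B C = stripZeros B ≡ stripZeros C

maxHeight : Board → ℕ
maxHeight = foldr _⊔_ 0

-- l_{k+1} = |B ∩ Q_{k+1}|, level k+1 = rows k*m+1, …, (k+1)*m.
levelCount : ℕ → Board → ℕ → ℕ
levelCount m B k = sum (map (λ b → (b ⊓ (suc k * m)) ∸ (k * m)) B)

-- l(B) = (l_t, …, l_1).  We list (l_K, …, l_1) with K = max height ≥ t
-- (as m ≥ 1) and remove the leading zeros l_K, …, l_{t+1}.
ell : ℕ → Board → Board
ell m B = stripZeros (reverse (map (levelCount m B) (upTo (maxHeight B))))

floorM : (m : ℕ) → .{{NonZero m}} → ℕ → ℕ
floorM m n = (n / m) * m

IsSingleton : (m : ℕ) → .{{NonZero m}} → Board → Set
IsSingleton m B = Linked (λ a b → floorM m a ≢ a → floorM m a < floorM m b) B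

IsIncreasing : ℕ → Board → Set
IsIncreasing m B = All (λ b → 0 < b) (stripZeros B) × Linked (λ a b → a + m ≤ b) (stripZeros B)
  where open import Data.Product using (_×_)

IsRestricted : ℕ → Board → Set
IsRestricted m B = Linked (λ a b → b ≤ a + m) (0 ∷ B)

-- Count cells row by row: writing N(h) for the number of columns taller than h, the level
-- l_{k+1} is the sum of N(h) over the m rows h of that level. If B is m-restricted, every
-- nonempty row h has a column ending in rows h+1..h+m, so N(h+m) < N(h); summing over a level
-- gives l_{k+1} + m ≤ l_k whenever l_{k+1} > 0. If B is m-increasing, at most one column ends
-- in rows h+1..h+m, so N(h) ≤ N(h+m) + 1 and l_k ≤ l_{k+1} + m.
-- For a singleton board read from the right, the cells in level k+1 of the successive columns
-- are m, …, m, r, 0, …, 0 with r < m: they pack l_{k+1} greedily into bins of size m. Hence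
-- column k+1 of l(B) has exactly as many cells in level i+1 as the (i+1)-st column of B from the
-- right has in level k+1, and summing over k recovers that column of B.
module Submission where

open import Defs
open import Data.Nat using (ℕ; NonZero; zero; suc; _+_; _*_; _∸_; _⊓_; _≤_; _<_; z≤n; s≤s; _≤?_; _<?_; >-nonZero⁻¹)
open import Data.Nat.Properties
open import Data.Nat.DivMod using (m*n/n≡m; /-monoˡ-≤; m<n*o⇒m/o<n)
open import Data.Nat.ListAction using (sum)
open import Data.Nat.ListAction.Properties using (sum-++; sum-↭)
open import Data.List using (List; []; _∷_; _++_; [_]; map; reverse; reverseAcc; upTo; applyUpTo; applyDownFrom)
open import Data.List.Properties
  using (map-cong; map-cong-local; map-∘; map-++; map-upTo; upTo-∷ʳ; reverse-applyUpTo; reverse-involutive; unfold-reverse)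
open import Data.List.Relation.Unary.All as All using (All; []; _∷_)
open import Data.List.Relation.Unary.All.Properties using () renaming (map⁺ to All-map⁺)
open import Data.List.Relation.Unary.Any as Any using (Any; here; there)
open import Data.List.Relation.Unary.Linked as Linked using (Linked; []; [-]; _∷_)
open import Data.List.Relation.Unary.Linked.Properties using (Linked⇒AllPairs; applyDownFrom⁺₂) renaming (map⁺ to Linked-map⁺)
open import Data.List.Relation.Unary.AllPairs using (_∷_)
open import Data.List.Relation.Binary.Permutation.Propositional using (↭-sym)
open import Data.List.Relation.Binary.Permutation.Propositional.Properties using (↭-reverse; All-resp-↭) renaming (map⁺ to ↭-map⁺)
open import Algebra.Properties.CommutativeSemigroup +-commutativeSemigroup using (x∙yz≈y∙xz)
open import Data.Product using (_×_; _,_)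
open import Data.Empty using (⊥-elim)
open import Function using (_∘_; flip)
open import Relation.Nullary using (yes; no)
open import Relation.Binary.PropositionalEquality hiding ([_])

-- Indexing with default 0: the columns beyond the end of a board have height 0.
nth : List ℕ → ℕ → ℕ
nth []       i       = 0
nth (x ∷ xs) zero    = x
nth (x ∷ xs) (suc i) = nth xs i

nth-map : ∀ {f : ℕ → ℕ} → f 0 ≡ 0 → ∀ xs i → nth (map f xs) i ≡ f (nth xs i)
nth-map f0 []       i       = sym f0
nth-map f0 (x ∷ xs) zero    = refl
nth-map f0 (x ∷ xs) (suc i) = nth-map f0 xs i

nth-applyUpTo : ∀ {f : ℕ → ℕ} n → (∀ i → n ≤ i → f i ≡ 0) → ∀ i → nth (applyUpTo f n) i ≡ f i
nth-applyUpTo zero    f0 i       = sym (f0 i z≤n)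
nth-applyUpTo (suc n) f0 zero    = refl
nth-applyUpTo (suc n) f0 (suc i) = nth-applyUpTo n (λ j n≤j → f0 (suc j) (s≤s n≤j)) i

nth-≤ : ∀ {c xs} → All (_≤ c) xs → ∀ i → nth xs i ≤ c
nth-≤ []       i       = z≤n
nth-≤ (p ∷ ps) zero    = p
nth-≤ (p ∷ ps) (suc i) = nth-≤ ps i

nth-zeros : ∀ {xs} → All (_≡ 0) xs → ∀ i → nth xs i ≡ 0
nth-zeros []       i       = refl
nth-zeros (p ∷ ps) zero    = p
nth-zeros (p ∷ ps) (suc i) = nth-zeros ps i

sum-zeros : ∀ {xs} → All (_≡ 0) xs → sum xs ≡ 0
sum-zeros []       = refl
sum-zeros (p ∷ ps) = cong₂ _+_ p (sum-zeros ps)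

sum-map-+ : ∀ (f g : ℕ → ℕ) xs → sum (map (λ x → f x + g x) xs) ≡ sum (map f xs) + sum (map g xs)
sum-map-+ f g []       = refl
sum-map-+ f g (x ∷ xs) = begin
  f x + g x + sum (map (λ x → f x + g x) xs)     ≡⟨ cong (f x + g x +_) (sum-map-+ f g xs) ⟩
  f x + g x + (sum (map f xs) + sum (map g xs))  ≡⟨ +-assoc (f x) (g x) _ ⟩
  f x + (g x + (sum (map f xs) + sum (map g xs))) ≡⟨ cong (f x +_) (x∙yz≈y∙xz (g x) (sum (map f xs)) (sum (map g xs))) ⟩
  f x + (sum (map f xs) + (g x + sum (map g xs))) ≡⟨ +-assoc (f x) _ _ ⟨
  f x + sum (map f xs) + (g x + sum (map g xs))  ∎
  where open ≡-Reasoning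

sum-map-mono : ∀ {f g : ℕ → ℕ} → (∀ x → f x ≤ g x) → ∀ xs → sum (map f xs) ≤ sum (map g xs)
sum-map-mono f≤g []       = z≤n
sum-map-mono f≤g (x ∷ xs) = +-mono-≤ (f≤g x) (sum-map-mono f≤g xs)

sum-map-reverse : ∀ (f : ℕ → ℕ) xs → sum (map f (reverse xs)) ≡ sum (map f xs)
sum-map-reverse f xs = sum-↭ (↭-map⁺ f (↭-reverse xs))

sum-map-upTo-suc : ∀ (f : ℕ → ℕ) n → sum (map f (upTo (suc n))) ≡ sum (map f (upTo n)) + f n
sum-map-upTo-suc f n = begin
  sum (map f (upTo (suc n)))          ≡⟨ cong (sum ∘ map f) (upTo-∷ʳ n) ⟨
  sum (map f (upTo n ++ [ n ]))       ≡⟨ cong sum (map-++ f (upTo n) [ n ]) ⟩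
  sum (map f (upTo n) ++ [ f n ])     ≡⟨ sum-++ (map f (upTo n)) [ f n ] ⟩
  sum (map f (upTo n)) + (f n + 0)    ≡⟨ cong (sum (map f (upTo n)) +_) (+-identityʳ (f n)) ⟩
  sum (map f (upTo n)) + f n          ∎
  where open ≡-Reasoning

reverse-map-upTo : ∀ (f : ℕ → ℕ) n → reverse (map f (upTo n)) ≡ applyDownFrom f n
reverse-map-upTo f n = trans (cong reverse (map-upTo f n)) (reverse-applyUpTo f n)

module _ {A : Set} {R : A → A → Set} where

  private
    reverseAcc⁺ : ∀ {x} acc xs → Linked (flip R) (x ∷ acc) → Linked R (x ∷ xs) →
                  Linked (flip R) (reverseAcc (x ∷ acc) xs)
    reverseAcc⁺ acc []       racc _         = racc
    reverseAcc⁺ acc (y ∷ ys) racc (r ∷ rxs) = reverseAcc⁺ (_ ∷ acc) ys (r ∷ racc) rxs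

  Linked-reverse⁺ : ∀ {xs} → Linked R xs → Linked (flip R) (reverse xs)
  Linked-reverse⁺ {[]}     []  = []
  Linked-reverse⁺ {x ∷ xs} rxs = reverseAcc⁺ [] xs [-] rxs

maxHeight-upper : ∀ B → All (_≤ maxHeight B) B
maxHeight-upper []      = []
maxHeight-upper (b ∷ B) = m≤m⊔n b _ ∷ All.map (λ p → ≤-trans p (m≤n⊔m b _)) (maxHeight-upper B)

stripZeros-idem : ∀ xs → stripZeros (stripZeros xs) ≡ stripZeros xs
stripZeros-idem []           = refl
stripZeros-idem (zero ∷ xs)  = stripZeros-idem xs
stripZeros-idem (suc x ∷ xs) = refl

stripZeros-++ : ∀ xs ys → stripZeros (xs ++ ys) ≡ stripZeros (stripZeros xs ++ ys)
stripZeros-++ []           ys = refl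
stripZeros-++ (zero ∷ xs)  ys = stripZeros-++ xs ys
stripZeros-++ (suc x ∷ xs) ys = refl

sum-map-stripZeros : ∀ {f : ℕ → ℕ} → f 0 ≡ 0 → ∀ xs → sum (map f (stripZeros xs)) ≡ sum (map f xs)
sum-map-stripZeros f0 []           = refl
sum-map-stripZeros {f} f0 (zero ∷ xs) = trans (sum-map-stripZeros f0 xs) (cong (_+ sum (map f xs)) (sym f0))
sum-map-stripZeros f0 (suc x ∷ xs) = refl

Linked-0∷-stripZeros : ∀ {R : ℕ → ℕ → Set} xs → Linked R (0 ∷ xs) → Linked R (0 ∷ stripZeros xs)
Linked-0∷-stripZeros []           r = r
Linked-0∷-stripZeros (zero ∷ xs)  r = Linked-0∷-stripZeros xs (Linked.tail r)
Linked-0∷-stripZeros (suc x ∷ xs) r = r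

stripZeros-reverse-∷ : ∀ x xs → stripZeros (reverse (x ∷ xs)) ≡ stripZeros (stripZeros (reverse xs) ++ [ x ])
stripZeros-reverse-∷ x xs = trans (cong stripZeros (unfold-reverse x xs)) (stripZeros-++ (reverse xs) [ x ])

nth-zeros⇒reverse-≈B[] : ∀ xs → (∀ i → nth xs i ≡ 0) → reverse xs ≈B []
nth-zeros⇒reverse-≈B[] []       eq = refl
nth-zeros⇒reverse-≈B[] (x ∷ xs) eq =
  trans (stripZeros-reverse-∷ x xs)
        (cong₂ (λ s z → stripZeros (s ++ [ z ])) (nth-zeros⇒reverse-≈B[] xs (eq ∘ suc)) (eq 0))

nth-≗⇒reverse-≈B : ∀ xs ys → (∀ i → nth xs i ≡ nth ys i) → reverse xs ≈B reverse ys
nth-≗⇒reverse-≈B []       ys       eq = sym (nth-zeros⇒reverse-≈B[] ys (sym ∘ eq))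
nth-≗⇒reverse-≈B (x ∷ xs) []       eq = nth-zeros⇒reverse-≈B[] (x ∷ xs) eq
nth-≗⇒reverse-≈B (x ∷ xs) (y ∷ ys) eq =
  trans (stripZeros-reverse-∷ x xs)
        (trans (cong₂ (λ s z → stripZeros (s ++ [ z ])) (nth-≗⇒reverse-≈B xs ys (eq ∘ suc)) (eq 0))
               (sym (stripZeros-reverse-∷ y ys)))

m⊓[n+o]≡m⊓n+[m∸n]⊓o : ∀ m n o → m ⊓ (n + o) ≡ m ⊓ n + (m ∸ n) ⊓ o
m⊓[n+o]≡m⊓n+[m∸n]⊓o zero    zero    o = refl
m⊓[n+o]≡m⊓n+[m∸n]⊓o zero    (suc n) o = refl
m⊓[n+o]≡m⊓n+[m∸n]⊓o (suc m) zero    o = refl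
m⊓[n+o]≡m⊓n+[m∸n]⊓o (suc m) (suc n) o = cong suc (m⊓[n+o]≡m⊓n+[m∸n]⊓o m n o)

cellsIn : ℕ → ℕ → ℕ → ℕ
cellsIn a w b = (b ∸ a) ⊓ w

cellsIn-full : ∀ {a w b} → w + a ≤ b → cellsIn a w b ≡ w
cellsIn-full {w = w} w+a≤b = m≥n⇒m⊓n≡n (m+n≤o⇒m≤o∸n w w+a≤b)

cellsIn-empty : ∀ {a w b} → b ≤ a → cellsIn a w b ≡ 0
cellsIn-empty b≤a rewrite m≤n⇒m∸n≡0 b≤a = refl

cellsIn-≤ : ∀ a w b → cellsIn a w b ≤ w
cellsIn-≤ a w b = m⊓n≤n (b ∸ a) w

cellsIn<⇒< : ∀ {a w b} → cellsIn a w b < w → b < w + a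
cellsIn<⇒< {a} {w} {b} c<w with w + a ≤? b
... | yes w+a≤b = ⊥-elim (<-irrefl (cellsIn-full w+a≤b) c<w)
... | no  w+a≰b = ≰⇒> w+a≰b

cellsIn-+ : ∀ a w v b → cellsIn a (w + v) b ≡ cellsIn a w b + cellsIn (a + w) v b
cellsIn-+ a w v b = trans (m⊓[n+o]≡m⊓n+[m∸n]⊓o (b ∸ a) w v) (cong (λ c → cellsIn a w b + c ⊓ v) (∸-+-assoc b a w))

cellsIn-shift : ∀ d a w b → cellsIn (d + a) w (d + b) ≡ cellsIn a w b
cellsIn-shift d a w b = cong (_⊓ w) ([m+n]∸[m+o]≡n∸o d b a)

cellsIn-antitone : ∀ {a a'} w b → a ≤ a' → cellsIn a' w b ≤ cellsIn a w b
cellsIn-antitone w b a≤a' = ⊓-monoˡ-≤ w (∸-monoʳ-≤ b a≤a')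

cells : ℕ → ℕ → Board → ℕ
cells a w B = sum (map (cellsIn a w) B)

levelCount≡cells : ∀ m B k → levelCount m B k ≡ cells (k * m) m B
levelCount≡cells m B k = cong sum (map-cong level B)
  where
  level : ∀ b → (b ⊓ (m + k * m)) ∸ k * m ≡ cellsIn (k * m) m b
  level b = trans (∸-distribʳ-⊓ (k * m) b (m + k * m)) (cong ((b ∸ k * m) ⊓_) (m+n∸n≡m m (k * m)))

cells-stripZeros : ∀ a w B → cells a w (stripZeros B) ≡ cells a w B
cells-stripZeros a w = sum-map-stripZeros (cellsIn-empty {a} {w} z≤n)

cells-width0 : ∀ a B → cells a 0 B ≡ 0
cells-width0 a []      = refl
cells-width0 a (b ∷ B) = cong₂ _+_ (⊓-zeroʳ (b ∸ a)) (cells-width0 a B)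

cells-suc : ∀ a w B → cells a (suc w) B ≡ cells a 1 B + cells (suc a) w B
cells-suc a w B = trans (cong sum (map-cong bottomRow B)) (sum-map-+ (cellsIn a 1) (cellsIn (suc a) w) B)
  where
  bottomRow : ∀ b → cellsIn a (suc w) b ≡ cellsIn a 1 b + cellsIn (suc a) w b
  bottomRow b = trans (cellsIn-+ a 1 w b) (cong (λ c → cellsIn a 1 b + cellsIn c w b) (+-comm a 1))

cells-antitone : ∀ {a a'} w B → a ≤ a' → cells a' w B ≤ cells a w B
cells-antitone w B a≤a' = sum-map-mono (λ b → cellsIn-antitone w b a≤a') B

cells-empty : ∀ {a} w {B} → All (_≤ a) B → cells a w B ≡ 0
cells-empty w []         = refl
cells-empty w (b≤a ∷ ps) = cong₂ _+_ (cellsIn-empty b≤a) (cells-empty w ps)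

cells-pos⇒Any : ∀ a w B → 0 < cells a w B → Any (a <_) B
cells-pos⇒Any a w (b ∷ B) pos with a <? b
... | yes a<b = here a<b
... | no  a≮b = there (cells-pos⇒Any a w B (subst (λ c → 0 < c + cells a w B) (cellsIn-empty (≮⇒≥ a≮b)) pos))

levelCount-vanishes : ∀ m .{{_ : NonZero m}} B {k} → maxHeight B ≤ k → levelCount m B k ≡ 0
levelCount-vanishes m B {k} K≤k =
  trans (levelCount≡cells m B k) (cells-empty m (All.map (λ b≤K → ≤-trans b≤K (≤-trans K≤k (m≤m*n k m))) (maxHeight-upper B)))

StepsAtLeast : ℕ → List ℕ → Set
StepsAtLeast m = Linked (λ x y → x + m ≤ y)

StepsAtMost : ℕ → List ℕ → Set
StepsAtMost m = Linked (λ x y → y ≤ x + m)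

1+x+[w+y]≡suc[w]+[x+y] : ∀ x w y → (1 + x) + (w + y) ≡ suc w + (x + y)
1+x+[w+y]≡suc[w]+[x+y] x w y = cong suc (x∙yz≈y∙xz x w y)

module _ (m : ℕ) where

  private
    positive-chain : ∀ {x xs} → Linked (λ a b → 0 < a → a + m ≤ b) (x ∷ xs) → 0 < x →
                     All (0 <_) (x ∷ xs) × StepsAtLeast m (x ∷ xs)
    positive-chain [-]            pos = (pos ∷ []) , [-]
    positive-chain (step ∷ chain) pos with positive-chain chain (<-≤-trans pos (≤-trans (m≤m+n _ m) (step pos)))
    ... | allPos , steps = (pos ∷ allPos) , (step pos ∷ steps)

  stripZeros-increasing : ∀ xs → Linked (λ a b → 0 < a → a + m ≤ b) xs → IsIncreasing m (stripZeros xs)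
  stripZeros-increasing []           _     = [] , []
  stripZeros-increasing (zero ∷ xs)  chain = stripZeros-increasing xs (Linked.tail chain)
  stripZeros-increasing (suc x ∷ xs) chain = positive-chain chain (s≤s z≤n)

  row≤1+rowAbove : ∀ h {B} → StepsAtLeast m B → cells h 1 B ≤ 1 + cells (m + h) 1 B
  row≤1+rowAbove h {[]}    steps = z≤n
  row≤1+rowAbove h {b ∷ B} steps with h <? b
  ... | yes h<b = begin
    cellsIn h 1 b + cells h 1 B                   ≡⟨ cong₂ _+_ (cellsIn-full h<b) rowsAgree ⟩
    1 + cells (m + h) 1 B                         ≤⟨ +-monoʳ-≤ 1 (m≤n+m _ _) ⟩
    1 + (cellsIn (m + h) 1 b + cells (m + h) 1 B) ∎
    where
    open ≤-Reasoning
    above : All (λ c → b + m ≤ c) B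
    above with Linked⇒AllPairs (λ p q → ≤-trans p (≤-trans (m≤m+n _ m) q)) steps
    ... | b+m≤B ∷ _ = b+m≤B
    rowsAgree : cells h 1 B ≡ cells (m + h) 1 B
    rowsAgree = cong sum (map-cong-local (All.map bothFull above))
      where
      bothFull : ∀ {c} → b + m ≤ c → cellsIn h 1 c ≡ cellsIn (m + h) 1 c
      bothFull b+m≤c = trans (cellsIn-full (<-≤-trans h<b (≤-trans (m≤m+n b m) b+m≤c)))
        (sym (cellsIn-full (<-≤-trans (+-monoʳ-< m h<b) (≤-trans (≤-reflexive (+-comm m b)) b+m≤c))))
  ... | no  h≮b = begin
    cellsIn h 1 b + cells h 1 B                   ≡⟨ cong (_+ cells h 1 B) (cellsIn-empty (≮⇒≥ h≮b)) ⟩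
    cells h 1 B                                   ≤⟨ row≤1+rowAbove h (Linked.tail steps) ⟩
    1 + cells (m + h) 1 B                         ≤⟨ +-monoʳ-≤ 1 (m≤n+m _ _) ⟩
    1 + (cellsIn (m + h) 1 b + cells (m + h) 1 B) ∎
    where open ≤-Reasoning

  cells≤w+cellsAbove : ∀ {B} → StepsAtLeast m B → ∀ a w → cells a w B ≤ w + cells (m + a) w B
  cells≤w+cellsAbove {B} steps a zero    = ≤-trans (≤-reflexive (cells-width0 a B)) z≤n
  cells≤w+cellsAbove {B} steps a (suc w) = begin
    cells a (suc w) B                                      ≡⟨ cells-suc a w B ⟩
    cells a 1 B + cells (suc a) w B                        ≤⟨ +-mono-≤ (row≤1+rowAbove a steps) (cells≤w+cellsAbove steps (suc a) w) ⟩
    (1 + cells (m + a) 1 B) + (w + cells (m + suc a) w B)  ≡⟨ cong (λ c → (1 + cells (m + a) 1 B) + (w + cells c w B)) (+-suc m a) ⟩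
    (1 + cells (m + a) 1 B) + (w + cells (suc (m + a)) w B) ≡⟨ 1+x+[w+y]≡suc[w]+[x+y] (cells (m + a) 1 B) w (cells (suc (m + a)) w B) ⟩
    suc w + (cells (m + a) 1 B + cells (suc (m + a)) w B)  ≡⟨ cong (suc w +_) (cells-suc (m + a) w B) ⟨
    suc w + cells (m + a) (suc w) B                        ∎
    where open ≤-Reasoning

  -- The first column taller than h exceeds its predecessor (of height ≤ h) by at most m, so it ends in rows h+1..h+m.
  rowAbove<row : ∀ {p} h {B} → StepsAtMost m (p ∷ B) → p ≤ h → Any (h <_) B → cells (m + h) 1 B < cells h 1 B
  rowAbove<row h {b ∷ B} (b≤p+m ∷ steps) p≤h tall with h <? b
  ... | yes h<b = begin-strict
    cellsIn (m + h) 1 b + cells (m + h) 1 B  ≡⟨ cong (_+ cells (m + h) 1 B) (cellsIn-empty b≤m+h) ⟩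
    cells (m + h) 1 B                        ≤⟨ cells-antitone 1 B (m≤n+m h m) ⟩
    cells h 1 B                              <⟨ n<1+n _ ⟩
    1 + cells h 1 B                          ≡⟨ cong (_+ cells h 1 B) (cellsIn-full h<b) ⟨
    cellsIn h 1 b + cells h 1 B              ∎
    where
    open ≤-Reasoning
    b≤m+h : b ≤ m + h
    b≤m+h = ≤-trans b≤p+m (≤-trans (+-monoˡ-≤ m p≤h) (≤-reflexive (+-comm h m)))
  ... | no  h≮b = begin-strict
    cellsIn (m + h) 1 b + cells (m + h) 1 B  ≡⟨ cong (_+ cells (m + h) 1 B) (cellsIn-empty (≤-trans b≤h (m≤n+m h m))) ⟩
    cells (m + h) 1 B                        <⟨ rowAbove<row h steps b≤h (Any.tail h≮b tall) ⟩
    cells h 1 B                              ≡⟨ cong (_+ cells h 1 B) (cellsIn-empty b≤h) ⟨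
    cellsIn h 1 b + cells h 1 B              ∎
    where
    open ≤-Reasoning
    b≤h : b ≤ h
    b≤h = ≮⇒≥ h≮b

  w+cellsAbove≤cells : ∀ {B} → StepsAtMost m (0 ∷ B) → ∀ a w → Any (w + a ≤_) B → w + cells (m + a) w B ≤ cells a w B
  w+cellsAbove≤cells {B} steps a zero    tall = ≤-reflexive (trans (cells-width0 (m + a) B) (sym (cells-width0 a B)))
  w+cellsAbove≤cells {B} steps a (suc w) tall = begin
    suc w + cells (m + a) (suc w) B                         ≡⟨ cong (suc w +_) (cells-suc (m + a) w B) ⟩
    suc w + (cells (m + a) 1 B + cells (suc (m + a)) w B)   ≡⟨ 1+x+[w+y]≡suc[w]+[x+y] (cells (m + a) 1 B) w (cells (suc (m + a)) w B) ⟨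
    (1 + cells (m + a) 1 B) + (w + cells (suc (m + a)) w B) ≡⟨ cong (λ c → (1 + cells (m + a) 1 B) + (w + cells c w B)) (+-suc m a) ⟨
    (1 + cells (m + a) 1 B) + (w + cells (m + suc a) w B)   ≤⟨ +-mono-≤ bottomRow (w+cellsAbove≤cells steps (suc a) w tallAbove) ⟩
    cells a 1 B + cells (suc a) w B                         ≡⟨ cells-suc a w B ⟨
    cells a (suc w) B                                       ∎
    where
    open ≤-Reasoning
    bottomRow : 1 + cells (m + a) 1 B ≤ cells a 1 B
    bottomRow = rowAbove<row a steps z≤n (Any.map (≤-trans (s≤s (m≤n+m a w))) tall)
    tallAbove : Any (w + suc a ≤_) B
    tallAbove = Any.map (≤-trans (≤-reflexive (+-suc w a))) tall

  levelCount-restricted : ∀ {B} → IsRestricted m B → ∀ k →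
                          0 < levelCount m B (suc k) → levelCount m B (suc k) + m ≤ levelCount m B k
  levelCount-restricted {B} restricted k pos
    rewrite levelCount≡cells m B (suc k) | levelCount≡cells m B k =
      ≤-trans (≤-reflexive (+-comm _ m))
        (w+cellsAbove≤cells restricted (k * m) m (Any.map <⇒≤ (cells-pos⇒Any (m + k * m) m B pos)))

  levelCount-increasing : ∀ {B} → StepsAtLeast m (stripZeros B) → ∀ k → levelCount m B k ≤ levelCount m B (suc k) + m
  levelCount-increasing {B} steps k
    rewrite levelCount≡cells m B (suc k) | levelCount≡cells m B k
          | sym (cells-stripZeros (k * m) m B) | sym (cells-stripZeros (m + k * m) m B) =
      ≤-trans (cells≤w+cellsAbove steps (k * m) m) (≤-reflexive (+-comm m _))

-- The list fills bins of capacity m in order: after a bin that is not full, all bins are empty.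
Packed : ℕ → List ℕ → Set
Packed m = Linked (λ c d → c < m → d ≡ 0)

module _ (m : ℕ) .{{_ : NonZero m}} where

  Packed-tail-zeros : ∀ {c cs} → Packed m (c ∷ cs) → c < m → All (_≡ 0) cs
  Packed-tail-zeros [-]           c<m = []
  Packed-tail-zeros (empty ∷ pck) c<m = empty c<m ∷ Packed-tail-zeros pck (subst (_< m) (sym (empty c<m)) (>-nonZero⁻¹ m))

  Packed-cellsIn-sum : ∀ cs → All (_≤ m) cs → Packed m cs → ∀ i → cellsIn (i * m) m (sum cs) ≡ nth cs i
  Packed-cellsIn-sum []       _            _   i = cellsIn-empty {i * m} {m} z≤n
  Packed-cellsIn-sum (c ∷ cs) (c≤m ∷ cs≤m) pck i with c <? m
  ... | yes c<m rewrite sum-zeros (Packed-tail-zeros pck c<m) | +-identityʳ c = partialBin i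
    where
    partialBin : ∀ i → cellsIn (i * m) m c ≡ nth (c ∷ cs) i
    partialBin zero    = m≤n⇒m⊓n≡m c≤m
    partialBin (suc i) = trans (cellsIn-empty (≤-trans c≤m (m≤m+n m (i * m))))
                               (sym (nth-zeros (Packed-tail-zeros pck c<m) i))
  ... | no  c≮m rewrite ≤-antisym c≤m (≮⇒≥ c≮m) = fullBin i
    where
    fullBin : ∀ i → cellsIn (i * m) m (m + sum cs) ≡ nth (m ∷ cs) i
    fullBin zero    = cellsIn-full (≤-trans (≤-reflexive (+-identityʳ m)) (m≤m+n m (sum cs)))
    fullBin (suc i) = trans (cellsIn-shift m (i * m) m (sum cs)) (Packed-cellsIn-sum cs cs≤m (Linked.tail pck) i)

  floorM-level : ∀ {k a} → k * m ≤ a → a < m + k * m → floorM m a ≡ k * m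
  floorM-level {k} km≤a a<m+km = cong (_* m) (≤-antisym (≤-pred (m<n*o⇒m/o<n a<m+km))
    (≤-trans (≤-reflexive (sym (m*n/n≡m k m))) (/-monoˡ-≤ m km≤a)))

  -- A column b to the right of a that is not full in level k+1 leaves its left neighbour a
  -- empty there: otherwise a would be a non-multiple of m with the same floor as b.
  singleton-level-step : ∀ k {a b} → a ≤ b → (floorM m a ≢ a → floorM m a < floorM m b) →
                         cellsIn (k * m) m b < m → cellsIn (k * m) m a ≡ 0
  singleton-level-step k {a} {b} a≤b singleton b-partial with a ≤? k * m
  ... | yes a≤km = cellsIn-empty a≤km
  ... | no  a≰km = ⊥-elim (<-irrefl (trans floor-a (sym floor-b)) (singleton (λ eq → <-irrefl (trans (sym floor-a) eq) km<a)))
    where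
    km<a : k * m < a
    km<a = ≰⇒> a≰km
    b<m+km : b < m + k * m
    b<m+km = cellsIn<⇒< b-partial
    floor-a : floorM m a ≡ k * m
    floor-a = floorM-level {k} (<⇒≤ km<a) (≤-<-trans a≤b b<m+km)
    floor-b : floorM m b ≡ k * m
    floor-b = floorM-level {k} (≤-trans (<⇒≤ km<a) a≤b) b<m+km

  singleton-level-Packed : ∀ {B} → IsFerrers B → IsSingleton m B → ∀ k → Packed m (map (cellsIn (k * m) m) (reverse B))
  singleton-level-Packed ferrers singleton k =
    Linked-map⁺ (Linked-reverse⁺ (Linked.zipWith (λ (a≤b , sg) → singleton-level-step k a≤b sg) (ferrers , singleton)))

cellsIn-levels : ∀ m x K → sum (map (λ k → cellsIn (k * m) m x) (upTo K)) ≡ cellsIn 0 (K * m) x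
cellsIn-levels m x zero    = sym (⊓-zeroʳ x)
cellsIn-levels m x (suc K) = begin
  sum (map (λ k → cellsIn (k * m) m x) (upTo (suc K)))              ≡⟨ sum-map-upTo-suc (λ k → cellsIn (k * m) m x) K ⟩
  sum (map (λ k → cellsIn (k * m) m x) (upTo K)) + cellsIn (K * m) m x ≡⟨ cong (_+ cellsIn (K * m) m x) (cellsIn-levels m x K) ⟩
  cellsIn 0 (K * m) x + cellsIn (K * m) m x                          ≡⟨ cellsIn-+ 0 (K * m) m x ⟨
  cellsIn 0 (K * m + m) x                                            ≡⟨ cong (λ w → cellsIn 0 w x) (+-comm (K * m) m) ⟩
  cellsIn 0 (suc K * m) x                                            ∎
  where open ≡-Reasoning

ell≡stripZeros-applyDownFrom : ∀ m B → ell m B ≡ stripZeros (applyDownFrom (levelCount m B) (maxHeight B))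
ell≡stripZeros-applyDownFrom m B = cong stripZeros (reverse-map-upTo (levelCount m B) (maxHeight B))

module _ (m : ℕ) .{{_ : NonZero m}} where

  restricted⇒ell-increasing : (B : Board) → IsFerrers B → IsRestricted m B → IsIncreasing m (ell m B)
  restricted⇒ell-increasing B _ restricted rewrite ell≡stripZeros-applyDownFrom m B =
    stripZeros-increasing m _ (applyDownFrom⁺₂ (levelCount m B) (maxHeight B) (levelCount-restricted m restricted))

  increasing⇒ell-restricted : (B : Board) → IsFerrers B → IsIncreasing m B → IsRestricted m (ell m B)
  increasing⇒ell-restricted B _ (_ , steps) rewrite ell≡stripZeros-applyDownFrom m B =
    Linked-0∷-stripZeros (applyDownFrom L K)
      (subst (λ top → StepsAtMost m (top ∷ applyDownFrom L K)) (levelCount-vanishes m B ≤-refl)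
        (applyDownFrom⁺₂ L (suc K) (levelCount-increasing m {B} steps)))
    where
    L = levelCount m B
    K = maxHeight B

  levelCount-ell : ∀ {B} → IsFerrers B → IsSingleton m B → ∀ i → levelCount m (ell m B) i ≡ nth (reverse B) i
  levelCount-ell {B} ferrers singleton i = begin
    levelCount m (ell m B) i                                ≡⟨ levelCount≡cells m (ell m B) i ⟩
    cells (i * m) m (ell m B)                               ≡⟨ cells-stripZeros (i * m) m (reverse (map L (upTo K))) ⟩
    cells (i * m) m (reverse (map L (upTo K)))              ≡⟨ sum-map-reverse (cellsIn (i * m) m) (map L (upTo K)) ⟩
    sum (map (cellsIn (i * m) m) (map L (upTo K)))          ≡⟨ cong sum (map-∘ (upTo K)) ⟨
    sum (map (λ k → cellsIn (i * m) m (L k)) (upTo K))      ≡⟨ cong sum (map-cong transpose (upTo K)) ⟩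
    sum (map (λ k → cellsIn (k * m) m (nth R i)) (upTo K))  ≡⟨ cellsIn-levels m (nth R i) K ⟩
    cellsIn 0 (K * m) (nth R i)                             ≡⟨ m≤n⇒m⊓n≡m (≤-trans (nth-≤ R≤K i) (m≤m*n K m)) ⟩
    nth R i                                                 ∎
    where
    open ≡-Reasoning
    L = levelCount m B
    K = maxHeight B
    R = reverse B
    R≤K : All (_≤ K) R
    R≤K = All-resp-↭ (↭-sym (↭-reverse B)) (maxHeight-upper B)
    transpose : ∀ k → cellsIn (i * m) m (L k) ≡ cellsIn (k * m) m (nth R i)
    transpose k = begin
      cellsIn (i * m) m (L k)                               ≡⟨ cong (cellsIn (i * m) m) (trans (levelCount≡cells m B k) (sym (sum-map-reverse _ B))) ⟩
      cellsIn (i * m) m (sum (map (cellsIn (k * m) m) R))   ≡⟨ Packed-cellsIn-sum m _ (All-map⁺ (All.universal (cellsIn-≤ (k * m) m) R))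
                                                                 (singleton-level-Packed m ferrers singleton k) i ⟩
      nth (map (cellsIn (k * m) m) R) i                     ≡⟨ nth-map (cellsIn-empty {k * m} {m} z≤n) R i ⟩
      cellsIn (k * m) m (nth R i)                           ∎

  singleton⇒ell-involutive : (B : Board) → IsFerrers B → IsSingleton m B → ell m (ell m B) ≈B B
  singleton⇒ell-involutive B ferrers singleton = begin
    stripZeros (ell m X)                    ≡⟨ stripZeros-idem (reverse (map L (upTo K))) ⟩
    stripZeros (reverse (map L (upTo K)))   ≡⟨ cong (stripZeros ∘ reverse) (map-upTo L K) ⟩
    stripZeros (reverse (applyUpTo L K))    ≡⟨ nth-≗⇒reverse-≈B (applyUpTo L K) (reverse B) columns ⟩
    stripZeros (reverse (reverse B))        ≡⟨ cong stripZeros (reverse-involutive B) ⟩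
    stripZeros B                            ∎
    where
    open ≡-Reasoning
    X = ell m B
    L = levelCount m X
    K = maxHeight X
    columns : ∀ i → nth (applyUpTo L K) i ≡ nth (reverse B) i
    columns i = trans (nth-applyUpTo K (λ _ → levelCount-vanishes m X) i) (levelCount-ell ferrers singleton i)

proposition7p4 : (m : ℕ) → .{{_ : NonZero m}} →
    ((B : Board) → IsFerrers B → IsRestricted m B → IsIncreasing m (ell m B))
    × ((B : Board) → IsFerrers B → IsIncreasing m B → IsRestricted m (ell m B))
    × ((B : Board) → IsFerrers B → IsSingleton m B → ell m (ell m B) ≈B B)
proposition7p4 m = restricted⇒ell-increasing m , increasing⇒ell-restricted m , singleton⇒ell-involutive m
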